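{- Let $t,r$ be integers with $t\geq 6$ and $r\in\{1,2\}$. Write $t-2=2p+q$ with $p$ an integer and $q\in\{0,1\}$. Then $$\operatorname{gr}_4(P_5:S_t^r)=t+p-1 .$$
   Context: All graphs are finite, simple and undirected. $K_n$ is the complete graph on $n$ vertices and $P_5$ is the path with $5$ vertices and $4$ edges. $S_t^r$ is the graph of order $t$ obtained from the star $K_{1,t-1}$ by adding $r$ pairwise independent edges between the leaves, so that it has $r$ triangles (sharing the center) and $t-2r-1$ pendent edges. A $k$-edge-coloring assigns to each edge one of $k$ colors; all $k$-edge-colorings are assumed exact, i.e. each of the $k$ colors is used at least once. An edge-colored graph is rainbow if all its edges have different colors and monochromatic if all its edges have a single color. A copy of a graph means a (not necessarily induced) subgraph isomorphic to it. For non-empty graphs $G,H$ (graphs with at least one edge) and a positive integer $k$, the Gallai-Ramsey number $\operatorname{gr}_k(G:H)$ is the minimum integer $N$ with $\binom{N}{2}\geq k$ (so that $K_N$ admits a $k$-edge-coloring) such that for all $n\geq N$, every $k$-edge-coloring of $K_n$ contains either a rainbow copy of $G$ or a monochromatic copy of $H$. -}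

module Defs where

open import Data.Fin.Base using (Fin; toℕ)
import Data.Fin.Properties as Fin
open import Data.Nat.Base using (ℕ; suc; _*_; _≤_; _<_)
open import Data.Nat.Combinatorics using (_C_)
open import Data.Nat.Properties using (_≟_; anyUpTo?; 1+n≢n)
open import Data.Product.Base using (_×_; _,_; ∃-syntax)
open import Data.Sum.Base using (_⊎_; inj₁; inj₂; [_,_]′)
open import Function.Definitions using (Injective)
open import Relation.Binary.Construct.Closure.Symmetric using (SymClosure; fwd; bwd; symmetric)
open import Relation.Binary.Core using (Rel)
open import Relation.Binary.Definitions using (Symmetric; Irreflexive; Decidable)
open import Relation.Binary.PropositionalEquality using (_≡_; _≢_; refl; sym; trans; ≢-sym)
open import Relation.Nullary.Decidable using (map′; ¬?; _×-dec_; _⊎-dec_)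
open import Level using (0ℓ)

record Graph : Set₁ where
  field
    order      : ℕ
    Adj        : Rel (Fin order) 0ℓ
    adj?       : Decidable Adj
    adj-sym    : Symmetric Adj
    adj-irrefl : Irreflexive _≡_ Adj

  Vertex : Set
  Vertex = Fin order

open Graph using (order; Vertex; Adj)

symClosure? : ∀ {n} {R : Rel (Fin n) 0ℓ} → Decidable R → Decidable (SymClosure R)
symClosure? R? i j = map′ [ fwd , bwd ]′
  (λ { (fwd e) → inj₁ e ; (bwd e) → inj₂ e }) (R? i j ⊎-dec R? j i)

symClosure-irrefl : ∀ {n} {R : Rel (Fin n) 0ℓ} →
                    Irreflexive _≡_ R → Irreflexive _≡_ (SymClosure R)
symClosure-irrefl irr eq (fwd e) = irr eq e
symClosure-irrefl irr eq (bwd e) = irr (sym eq) e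

fromDirected : ∀ {n} (R : Rel (Fin n) 0ℓ) → Decidable R → Irreflexive _≡_ R → Graph
fromDirected {n} R R? irr = record
  { order      = n
  ; Adj        = SymClosure R
  ; adj?       = symClosure? R?
  ; adj-sym    = symmetric R
  ; adj-irrefl = symClosure-irrefl irr
  }

K : ℕ → Graph
K n = record
  { order      = n
  ; Adj        = _≢_
  ; adj?       = λ i j → ¬? (i Fin.≟ j)
  ; adj-sym    = ≢-sym
  ; adj-irrefl = λ eq i≢j → i≢j eq
  }

-- The path with n vertices (not n edges).
P : ℕ → Graph
P n = fromDirected {n} (λ i j → toℕ j ≡ suc (toℕ i))
  (λ i j → toℕ j ≟ suc (toℕ i))
  (λ { refl eq → 1+n≢n (sym eq) })

-- Vertex 0 is the centre; the r added edges join the leaves 1 and 2, 3 and 4,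
-- …, 2r-1 and 2r.
data StarEdge {t : ℕ} (r : ℕ) (i j : Fin t) : Set where
  spoke : toℕ i ≡ 0 → toℕ j ≢ 0 → StarEdge r i j
  rim   : ∃[ s ] (s < r × toℕ i ≡ suc (2 * s) × toℕ j ≡ suc (suc (2 * s))) →
          StarEdge r i j

starEdge? : ∀ {t} r → Decidable (StarEdge {t} r)
starEdge? r i j = map′
  [ (λ { (p , q) → spoke p q }) , rim ]′
  (λ { (spoke p q) → inj₁ (p , q) ; (rim e) → inj₂ e })
  ((toℕ i ≟ 0 ×-dec ¬? (toℕ j ≟ 0)) ⊎-dec
   anyUpTo? (λ s → toℕ i ≟ suc (2 * s) ×-dec toℕ j ≟ suc (suc (2 * s))) r)

starEdge-irrefl : ∀ {t} r → Irreflexive _≡_ (StarEdge {t} r)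
starEdge-irrefl r refl (spoke p q)            = q p
starEdge-irrefl r refl (rim (s , _ , p , q)) = 1+n≢n (trans (sym q) p)

-- S t r is S_t^r.  It is meaningful only for 2r < t, so that there are enough
-- leaves; otherwise the added edges that do not fit are silently missing.
S : ℕ → ℕ → Graph
S t r = fromDirected {t} (StarEdge r) (starEdge? r) (starEdge-irrefl r)

-- A copy of G in F; its edges are the images of the edges of G.
record Copy (G F : Graph) : Set where
  field
    map       : Vertex G → Vertex F
    injective : Injective _≡_ _≡_ map
    preserves : ∀ {u v} → Adj G u v → Adj F (map u) (map v)

-- An exact k-edge-colouring.  The values of colour at non-adjacent pairs
-- (in particular on the diagonal) carry no meaning and are never used.
record EdgeColouring (k : ℕ) (F : Graph) : Set where
  field
    colour     : Vertex F → Vertex F → Fin k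
    colour-sym : ∀ u v → colour u v ≡ colour v u
    exact      : ∀ c → ∃[ u ] ∃[ v ] (Adj F u v × colour u v ≡ c)

module _ {k : ℕ} {F : Graph} (χ : EdgeColouring k F) where
  open EdgeColouring χ

  -- Edges of the copy with equal colours are equal as unordered pairs.
  Rainbow : ∀ {G} → Copy G F → Set
  Rainbow {G} f = ∀ {u v x y} → Adj G u v → Adj G x y →
    colour (map u) (map v) ≡ colour (map x) (map y) →
    (u ≡ x × v ≡ y) ⊎ (u ≡ y × v ≡ x)
    where open Copy f

  Monochromatic : ∀ {G} → Copy G F → Set
  Monochromatic {G} f = ∃[ c ] (∀ {u v} → Adj G u v → colour (map u) (map v) ≡ c)
    where open Copy f

GallaiRamseyBound : ℕ → Graph → Graph → ℕ → Set
GallaiRamseyBound k G H N =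
  k ≤ N C 2 ×
  (∀ n → N ≤ n → (χ : EdgeColouring k (K n)) →
    (∃[ f ] Rainbow χ {G} f) ⊎ (∃[ f ] Monochromatic χ {H} f))

-- gr_k(G : H) = N.  It is a relation because the existence of a minimum is not
-- part of the definition.
gr[_][_∶_]≡_ : ℕ → Graph → Graph → ℕ → Set
gr[ k ][ G ∶ H ]≡ N =
  GallaiRamseyBound k G H N × (∀ M → GallaiRamseyBound k G H M → N ≤ M)

{-# OPTIONS --safe #-}

-- Upper bound.  Suppose K_n has no rainbow P₅.  If no vertex sees three
-- colours, then any two of the sets of colours seen at the vertices meet, so one
-- colour lies in all of them and the other three live on disjoint vertex sets.
-- The smallest of these has at most n / 3 vertices, and any of its vertices is
-- joined in the common colour to everything outside it.  If some vertex sees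
-- three colours, there is a rainbow triangle with a pendant edge of the fourth
-- colour; following its extensions by one vertex leads to a vertex with at most
-- one incident edge not in a single colour.  In both cases this vertex is the
-- centre of two triangles of its dominant colour and has enough neighbours in
-- that colour for a monochromatic S t r with r ≤ 2.  The local claims concern at
-- most six vertices and are settled by an exhaustive search that returns proofs.
--
-- Lower bound.  Split 3p + q vertices into three blocks of at least p vertices,
-- give the edges between blocks one colour and each block a colour of its own.
-- Two consecutive edges of a rainbow path cannot both lie inside blocks, and
-- the star in S t r would avoid some block altogether.

module Submission where

open import Defs
import Data.Fin.Properties as Fin
import Data.List.Base as List
import Data.List.Membership.DecPropositional as DecMembership
import Data.List.Relation.Unary.AllPairs as ListPairs
import Data.List.Relation.Unary.Any as Any
import Data.List.Relation.Unary.Unique.Propositional as ListUnique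
import Data.List.Relation.Unary.Unique.Propositional.Properties as ListUnique
import Data.Maybe.Base as Maybe
import Data.Maybe.Effectful as Maybe
import Data.Nat.Properties as ℕ
import Data.Product.Base as Product
import Data.Vec.Base as Vec
import Data.Vec.Properties as Vec
import Data.Vec.Relation.Unary.All as VecAll
open import Data.Empty using (⊥; ⊥-elim)
open import Data.Fin.Base
  using (Fin; zero; suc; toℕ; combine; _↑ˡ_; splitAt; remQuot; inject₁; inject≤)
open import Data.Fin.Patterns using (0F; 1F; 2F; 3F; 4F; 5F; 6F)
open import Data.List.Base using (List; []; _∷_; _++_)
open import Data.List.Membership.Propositional using (_∈_; _∉_)
open import Data.List.Membership.Propositional.Properties
  using (∈-filter⁺; ∈-filter⁻; ∈-tabulate⁻; ∈-allFin; ∈-lookup; ∈-++⁺ˡ; ∈-++⁺ʳ; ∈-++⁻)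
open import Data.List.Properties using (length-++; length-tabulate)
open import Data.List.Relation.Unary.All as All using (All; []; _∷_)
open import Data.List.Relation.Unary.All.Properties using (map⁺)
open import Data.List.Relation.Unary.Any using (Any; here; there)
open import Data.List.Relation.Unary.Any.Properties using (lookup-index)
open import Data.Maybe.Base using (Maybe; just; nothing; _>>=_; _<∣>_; from-just)
open import Data.Nat.Base using (ℕ; zero; suc; _+_; _*_; _∸_; _≤_; z≤n; s≤s)
open import Data.Nat.Combinatorics using (_C_; nC1≡n; nCk+nC[k+1]≡[n+1]C[k+1])
open import Data.Nat.Tactic.RingSolver using (solve-∀)
open import Data.Product.Base using (∃; _×_; _,_; proj₁; proj₂)
open import Data.Product.Properties using (≡-dec)
open import Data.Sum.Base using (_⊎_; inj₁; inj₂; [_,_]; [_,_]′)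
open import Data.Vec.Base using (Vec; []; _∷_; lookup)
open import Data.Vec.Relation.Unary.All using ([]; _∷_)
open import Data.Vec.Relation.Unary.All.Properties using (lookup⁻)
open import Data.Vec.Relation.Unary.AllPairs using (allPairs?; []; _∷_)
open import Data.Vec.Relation.Unary.Unique.Propositional using (Unique)
open import Data.Vec.Relation.Unary.Unique.Propositional.Properties
  using (lookup-injective) renaming (map⁺ to unique-map⁺)
open import Function.Base using (_∘_; id; const; case_of_)
open import Function.Definitions using (Injective)
open import Relation.Binary.Construct.Closure.Symmetric using (fwd; bwd)
open import Relation.Binary.PropositionalEquality
  using (_≡_; _≢_; refl; sym; trans; cong; cong₂; subst; ≢-sym)
open import Relation.Nullary using (¬_; Dec; yes; no)
open import Relation.Nullary.Decidable
  using (True; toWitness; from-yes; dec⇒maybe; map′; ¬?; _×-dec_)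

-- Counting with repetition-free lists and vectors.

list-lookup-injective : ∀ {A : Set} {xs : List A} → ListUnique.Unique xs →
                        ∀ i j → List.lookup xs i ≡ List.lookup xs j → i ≡ j
list-lookup-injective (x# ListPairs.∷ xs!) 0F      0F      eq = refl
list-lookup-injective (x# ListPairs.∷ xs!) 0F      (suc j) eq =
  ⊥-elim (All.lookup x# (∈-lookup j) eq)
list-lookup-injective (x# ListPairs.∷ xs!) (suc i) 0F      eq =
  ⊥-elim (All.lookup x# (∈-lookup i) (sym eq))
list-lookup-injective (x# ListPairs.∷ xs!) (suc i) (suc j) eq =
  cong suc (list-lookup-injective xs! i j eq)

unique⊆⇒length≤ : ∀ {A : Set} {xs ys : List A} → ListUnique.Unique xs →
                  (∀ {x} → x ∈ xs → x ∈ ys) → List.length xs ≤ List.length ys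
unique⊆⇒length≤ {xs = xs} {ys} xs! xs⊆ys = Fin.injective⇒≤ index-injective
  where
  position : ∀ i → List.lookup xs i ∈ ys
  position i = xs⊆ys (∈-lookup i)
  index-injective : ∀ {i j} → Any.index (position i) ≡ Any.index (position j) → i ≡ j
  index-injective {i} {j} eq = list-lookup-injective xs! i j
    (trans (lookup-index (position i))
      (trans (cong (List.lookup ys) eq) (sym (lookup-index (position j)))))

unique? : ∀ {n k} (xs : Vec (Fin n) k) → Dec (Unique xs)
unique? = allPairs? (λ i j → ¬? (i Fin.≟ j))

unique⇒≤ : ∀ {n k} {xs : Vec (Fin n) k} → Unique xs → k ≤ n
unique⇒≤ xs! = Fin.injective⇒≤ (λ {i} {j} → lookup-injective xs! i j)

abstract

  locate : ∀ {n k} (xs : Vec (Fin n) k) v → (∃ λ i → v ≡ lookup xs i) ⊎ VecAll.All (v ≢_) xs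
  locate xs v with Fin.any? (λ i → v Fin.≟ lookup xs i)
  ... | yes found = inj₁ found
  ... | no v∉xs   = inj₂ (lookup⁻ (λ i eq → v∉xs (i , eq)))

  covers : ∀ {n} {xs : Vec (Fin n) n} → Unique xs → ∀ v → ∃ λ i → v ≡ lookup xs i
  covers {xs = xs} xs! v with locate xs v
  ... | inj₁ found = found
  ... | inj₂ v#xs  = ⊥-elim (ℕ.1+n≰n (unique⇒≤ (v#xs ∷ xs!)))

  fresh : ∀ {n k} (xs : Vec (Fin n) k) → suc k ≤ n → ∃ λ v → VecAll.All (v ≢_) xs
  fresh xs k<n with Fin.any? (λ v → VecAll.all? (λ x → ¬? (v Fin.≟ x)) xs)
  ... | yes v#xs    = v#xs
  ... | no covering = ⊥-elim (ℕ.<⇒≱ k<n (Fin.injective⇒≤ position-injective))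
    where
    located : ∀ v → ∃ λ i → v ≡ lookup xs i
    located v with locate xs v
    ... | inj₁ found = found
    ... | inj₂ v#xs  = ⊥-elim (covering (v , v#xs))
    position-injective : Injective _≡_ _≡_ (proj₁ ∘ located)
    position-injective {u} {v} eq =
      trans (proj₂ (located u)) (trans (cong (lookup xs) eq) (sym (proj₂ (located v))))

-- Edge patterns and their occurrences in a colouring.

Edge : ℕ → Set
Edge m = Fin m × Fin m

-- Colours are named by indices of frame edges rather than by their actual values.
Knowledge : ℕ → Set
Knowledge m = List (Edge m × Fin 4)

infix 3 _echoing_

-- The edges of the frame have pairwise different colours; an echo is an edge
-- together with the index of the frame edge whose colour it repeats.
record Pattern (m : ℕ) : Set where
  constructor _echoing_
  field
    frame  : Vec (Edge m) 4
    echoes : Knowledge m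
open Pattern

picks : ∀ {A : Set} → List A → List (A × List A)
picks []       = []
picks (x ∷ xs) = (x , xs) ∷ List.map (Product.map₂ (x ∷_)) (picks xs)

arrangements : ∀ {A : Set} k → List A → List (Vec A k)
arrangements zero    xs = [] ∷ []
arrangements (suc k) xs =
  List.concatMap (λ (x , rest) → List.map (x ∷_) (arrangements k rest)) (picks xs)

rename : ∀ {k m} → Vec (Fin m) k → Edge k → Edge m
rename τ (i , j) = lookup τ i , lookup τ j

rainbowP₅ : Pattern 5
rainbowP₅ = ((0F , 1F) ∷ (1F , 2F) ∷ (2F , 3F) ∷ (3F , 4F) ∷ []) echoing []

shift-edge : ∀ {m} → Edge m → Edge (suc m)
shift-edge (i , j) = suc i , suc j

-- Frees index 0 for a further vertex, which `occurs-shift` puts in front of `ρ`.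
shift : ∀ {m} → Pattern m → Pattern (suc m)
shift (frame echoing echoes) =
  Vec.map shift-edge frame echoing List.map (λ (e , i) → shift-edge e , i) echoes

any-vec? : ∀ {n k} {Q : Vec (Fin n) k → Set} → (∀ xs → Dec (Q xs)) → Dec (∃ Q)
any-vec? {k = zero}  Q? = map′ ([] ,_) (λ { ([] , q) → q }) (Q? [])
any-vec? {k = suc k} Q? = map′ (λ (x , xs , q) → x ∷ xs , q) (λ { (x ∷ xs , q) → x , xs , q })
  (Fin.any? (λ x → any-vec? (λ xs → Q? (x ∷ xs))))

module Occurrence {n} (χ : Fin n → Fin n → Fin 4) where

  colour : ∀ {m} → Vec (Fin n) m → Edge m → Fin 4
  colour ρ (i , j) = χ (lookup ρ i) (lookup ρ j)

  Occurs : ∀ {m} → Vec (Fin n) m → Pattern m → Set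
  Occurs ρ P = Unique γ × All (λ (e , k) → colour ρ e ≡ lookup γ k) (echoes P)
    where γ = Vec.map (colour ρ) (frame P)

  occurs-shift : ∀ {m} v (ρ : Vec (Fin n) m) P → Occurs ρ P → Occurs (v ∷ ρ) (shift P)
  occurs-shift v ρ P (frame! , echoes≡)
    rewrite sym (Vec.map-∘ (colour (v ∷ ρ)) shift-edge (frame P)) = frame! , map⁺ echoes≡

  Contains : ∀ {m} → Pattern m → Set
  Contains P = ∃ λ ρ → Unique ρ × Occurs ρ P

  Coloured-like : ∀ {m} → Vec (Fin n) m → Edge m → List (Edge m) → Set
  Coloured-like ρ e es = All (λ f → colour ρ f ≡ colour ρ e) es

  colour-map : ∀ {m k} (ρ : Vec (Fin n) m) (τ : Vec (Fin m) k) e →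
               colour (Vec.map (lookup ρ) τ) e ≡ colour ρ (rename τ e)
  colour-map ρ τ (i , j) =
    cong₂ χ (Vec.lookup-map i (lookup ρ) τ) (Vec.lookup-map j (lookup ρ) τ)

abstract
  contains? : ∀ {n m} (χ : Fin n → Fin n → Fin 4) (Q : Pattern m) →
              Dec (Occurrence.Contains χ Q)
  contains? χ Q = any-vec? λ ρ →
    unique? ρ ×-dec unique? _ ×-dec All.all? (λ _ → _ Fin.≟ _) (echoes Q)

-- Exhaustive search that returns proofs.

module Search {n} (χ : Fin n → Fin n → Fin 4) (χ-sym : ∀ u v → χ u v ≡ χ v u)
  (noP₅ : ¬ Occurrence.Contains χ rainbowP₅) {m} {ρ : Vec (Fin n) m} (ρ! : Unique ρ)
  (P : Pattern m) (occ : Occurrence.Occurs χ ρ P) where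
  open Occurrence χ

  γ : Fin 4 → Fin 4
  γ = lookup (Vec.map (colour ρ) (frame P))

  γ-injective : Injective _≡_ _≡_ γ
  γ-injective {i} {j} = lookup-injective (proj₁ occ) i j

  -- Four different colours out of four exhaust them, so branching over frame indices misses no
  -- colour.
  γ-surjective : ∀ c → ∃ λ k → c ≡ γ k
  γ-surjective = covers (proj₁ occ)

  Known : Knowledge m → Set
  Known = All (λ (e , k) → colour ρ e ≡ γ k)

  -- In every use `K` is concrete while `χ` and `ρ` are variables, so deductions evaluate during
  -- type checking and only the resulting proof mentions the colouring. `nothing` records that no
  -- derivation was found, not that the claim fails.
  Deduction : Set → Set
  Deduction A = ∀ K → Maybe (Known K → A)

  same-edge : ∀ e f → Maybe (colour ρ e ≡ colour ρ f)
  same-edge e@(i , j) f with ≡-dec Fin._≟_ Fin._≟_ e f | ≡-dec Fin._≟_ Fin._≟_ (j , i) f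
  ... | yes refl | _        = just refl
  ... | no _     | yes refl = just (χ-sym _ _)
  ... | no _     | no _     = nothing

  recall : ∀ K e → Maybe (∃ λ k → Known K → colour ρ e ≡ γ k)
  recall []            e = nothing
  recall ((f , k) ∷ K) e with same-edge e f
  ... | just e≈f = just (k , λ { (fk ∷ _) → trans e≈f fk })
  ... | nothing  = Maybe.map (Product.map₂ (_∘ All.tail)) (recall K e)

  recall-is : ∀ e k → Deduction (colour ρ e ≡ γ k)
  recall-is e k K = do
    (l , e≈l) ← recall K e
    l≡k ← dec⇒maybe (l Fin.≟ k)
    just (λ known → trans (e≈l known) (cong γ l≡k))

  recall-all : ∀ K {l} (es : Vec (Edge m) l) →
               Maybe (∃ λ ks → Known K → Vec.map (colour ρ) es ≡ Vec.map γ ks)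
  recall-all K []       = just ([] , const refl)
  recall-all K (e ∷ es) = do
    (k , e≈k)    ← recall K e
    (ks , es≈ks) ← recall-all K es
    just (k ∷ ks , λ known → cong₂ _∷_ (e≈k known) (es≈ks known))

  every : ∀ {B : Set} {A : B → Set} → (∀ b → Deduction (A b)) → ∀ bs → Deduction (All A bs)
  every d []       K = just (const [])
  every d (b ∷ bs) K = do
    h  ← d b K
    hs ← every d bs K
    just (λ known → h known ∷ hs known)

  -- `τ` places the vertices of `Q` among those of `P`. Distinctness is tested on indices and
  -- carries over to vertices and colours because `lookup ρ` and `γ` are injective.
  find-at : ∀ {k} (Q : Pattern k) → Vec (Fin m) k → Deduction (Contains Q)
  find-at Q τ K = do
    (ks , es≈ks) ← recall-all K (Vec.map (rename τ) (frame Q))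
    ks! ← dec⇒maybe (unique? ks)
    τ!  ← dec⇒maybe (unique? τ)
    hs  ← every (λ (e , i) → recall-is (rename τ e) (lookup ks i)) (echoes Q) K
    just (λ known →
      let frame≡ = trans (Vec.map-cong (colour-map ρ τ) (frame Q))
                     (trans (Vec.map-∘ (colour ρ) (rename τ) (frame Q)) (es≈ks known))
      in Vec.map (lookup ρ) τ
       , unique-map⁺ (λ {i} {j} → lookup-injective ρ! i j) τ!
       , subst Unique (sym frame≡) (unique-map⁺ γ-injective ks!)
       , All.map (λ {(e , i)} eq → trans (colour-map ρ τ e) (trans eq
           (sym (trans (cong (λ γ′ → lookup γ′ i) frame≡) (Vec.lookup-map i γ ks))))) (hs known))

  find : ∀ {k} (Q : Pattern k) → Deduction (Contains Q)
  find {k} Q K =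
    List.head (List.mapMaybe (λ τ → find-at Q τ K) (arrangements k (List.allFin m)))

  coloured-like : ∀ e es → Deduction (Coloured-like ρ e es)
  coloured-like e es K = do
    (k , e≈k) ← recall K e
    hs ← every (λ f → recall-is f k) es K
    just (λ known → All.map (λ f≈k → trans f≈k (sym (e≈k known))) (hs known))

  some-coloured-like : ∀ e ess → Deduction (Any (Coloured-like ρ e) ess)
  some-coloured-like e []         K = nothing
  some-coloured-like e (es ∷ ess) K =
    Maybe.map (here ∘_) (coloured-like e es K) <∣>
    Maybe.map (there ∘_) (some-coloured-like e ess K)

  infixr 5 _or_
  _or_ : ∀ {A B} → Deduction A → Deduction B → Deduction (A ⊎ B)
  (d or d′) K = Maybe.map (inj₁ ∘_) (d K) <∣> Maybe.map (inj₂ ∘_) (d′ K)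

  -- Branches on the colours of the listed edges in turn.  A branch is closed by
  -- the goal or by a rainbow P₅, so any list with enough edges works; the lists
  -- used below keep the search trees small.
  search : ∀ {A} → Deduction A → List (Edge m) → Deduction A
  search d es K with Maybe.map (λ h → ⊥-elim ∘ noP₅ ∘ h) (find rainbowP₅ K) <∣> d K | es
  ... | just h  | _      = just h
  ... | nothing | []     = nothing
  -- All four branches have to succeed; the actual colour of `e` then selects the one that applies.
  ... | nothing | e ∷ es = Maybe.map
    (λ h known → let (k , eq) = γ-surjective (colour ρ e) in h k (eq ∷ known))
    (Fin.sequence Maybe.applicative (λ k → search d es ((e , k) ∷ K)))

  solve : ∀ {A} → Deduction A → List (Edge m) → Maybe A
  solve d es = Maybe.map (λ h → h facts-known) (search d es facts)
    where
    facts : Knowledge m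
    facts = (lookup (frame P) 0F , 0F) ∷ (lookup (frame P) 1F , 1F) ∷
            (lookup (frame P) 2F , 2F) ∷ (lookup (frame P) 3F , 3F) ∷ echoes P
    facts-known : Known facts
    facts-known = named 0F ∷ named 1F ∷ named 2F ∷ named 3F ∷ proj₂ occ
      where
      named : ∀ i → colour ρ (lookup (frame P) i) ≡ γ i
      named i = sym (Vec.lookup-map i (colour ρ) (frame P))

-- Patterns for the upper bound.

fourStar : Pattern 5
fourStar = ((0F , 1F) ∷ (0F , 2F) ∷ (0F , 3F) ∷ (0F , 4F) ∷ []) echoing []

-- Vertex 0 sees three colours; the fourth is on an edge whose two ends it sees in the same colour.
book : Pattern 5
book = ((0F , 1F) ∷ (0F , 3F) ∷ (0F , 4F) ∷ (1F , 2F) ∷ []) echoing ((0F , 2F) , 0F) ∷ []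

-- For `i` at most 2, frame edge `i` is the side opposite corner `i` of a rainbow triangle; the last
-- one leaves corner 0 in the fourth colour.
pendant : Pattern 4
pendant = ((1F , 2F) ∷ (0F , 2F) ∷ (0F , 1F) ∷ (0F , 3F) ∷ []) echoing []

-- Vertices 3 and 4 are joined to each corner of the rainbow triangle 0 1 2 in the
-- colour of the opposite side.  On these five vertices there is no rainbow P₅,
-- but every sixth vertex creates one.
twinned : Pattern 5
twinned = ((1F , 2F) ∷ (0F , 2F) ∷ (0F , 1F) ∷ (3F , 4F) ∷ []) echoing
  ((3F , 0F) , 0F) ∷ ((3F , 1F) , 1F) ∷ ((3F , 2F) , 2F) ∷
  ((4F , 0F) , 0F) ∷ ((4F , 1F) , 1F) ∷ ((4F , 2F) , 2F) ∷ []

-- In the next two patterns the last colour of the frame is the dominant one: it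
-- will appear on all edges at vertex 1 of rainbowStar, and at vertex 3 of
-- rainbowTriangle, except perhaps on the edge to vertex 0.
rainbowStar : Pattern 4
rainbowStar = ((0F , 1F) ∷ (0F , 2F) ∷ (0F , 3F) ∷ (1F , 2F) ∷ []) echoing
  ((1F , 3F) , 3F) ∷ ((2F , 3F) , 3F) ∷ []

rainbowTriangle : Pattern 4
rainbowTriangle = ((0F , 1F) ∷ (0F , 2F) ∷ (1F , 2F) ∷ (3F , 1F) ∷ []) echoing
  ((3F , 2F) , 3F) ∷ []

-- Here 0 and 1 are two further vertices, and those of the pattern have become
-- 2, …, 5; the listed edges close triangles at the vertex of dominant colour.
starRims : List (Edge 6)
starRims = (4F , 0F) ∷ (5F , 1F) ∷ []

triangleRims : List (List (Edge 6))
triangleRims =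
  ((3F , 0F) ∷ (4F , 1F) ∷ []) ∷ ((3F , 1F) ∷ (4F , 0F) ∷ []) ∷
  ((0F , 1F) ∷ (3F , 0F) ∷ []) ∷ ((0F , 1F) ∷ (4F , 0F) ∷ []) ∷
  ((0F , 1F) ∷ (3F , 1F) ∷ []) ∷ ((0F , 1F) ∷ (4F , 1F) ∷ []) ∷ []

-- Colours seen at a vertex, and centres of large monochromatic stars.

module Hubs {n} (χ : Fin n → Fin n → Fin 4) where

  -- The exceptions are the vertices, including the centre itself, that need not be
  -- joined to the centre in colour c; the centre lies on the triangles with
  -- opposite sides y z and u w.
  record Hub (t : ℕ) : Set where
    field
      {centre y z u w} : Fin n
      {c}        : Fin 4
      exceptions : List (Fin n)
      leaves!    : Unique (y ∷ z ∷ u ∷ w ∷ [])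
      leaves∉    : VecAll.All (_∉ exceptions) (y ∷ z ∷ u ∷ w ∷ [])
      centre∈    : centre ∈ exceptions
      dominates  : ∀ {v} → v ∉ exceptions → χ centre v ≡ c
      yz≡        : χ y z ≡ c
      uw≡        : χ u w ≡ c
      -- The centre is itself an exception, so at least `t - 1` vertices are left as leaves.
      few        : t + List.length exceptions ≤ suc n

  Sees : Fin n → Fin 4 → Set
  Sees a c = ∃ λ b → a ≢ b × χ a b ≡ c

  sees? : ∀ a c → Dec (Sees a c)
  sees? a c = Fin.any? (λ b → ¬? (a Fin.≟ b) ×-dec (χ a b Fin.≟ c))

  Apart : Fin 4 → Fin 4 → Set
  Apart i j = ∀ {a} → Sees a i → ¬ Sees a j

  apart? : ∀ i j → (∃ λ a → Sees a i × Sees a j) ⊎ Apart i j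
  apart? i j with Fin.any? (λ a → sees? a i ×-dec sees? a j)
  ... | yes touching = inj₁ touching
  ... | no apart     = inj₂ (λ ai aj → apart (_ , ai , aj))

  apart-sym : ∀ {i j} → Apart i j → Apart j i
  apart-sym apart aj ai = apart ai aj

  apart-colours : ∀ {a b c} → χ a b ≢ χ a c → b ≢ c
  apart-colours ne refl = ne refl

-- Local consequences of having no rainbow path.

module P₅Free {n} (χ : Fin n → Fin n → Fin 4) (χ-sym : ∀ u v → χ u v ≡ χ v u)
  (exact : ∀ c → ∃ λ u → ∃ λ v → u ≢ v × χ u v ≡ c)
  (noP₅ : ¬ Occurrence.Contains χ rainbowP₅) where
  open Occurrence χ
  open Hubs χ

  -- Abstract, since unfolding these proofs replays the searches.
  abstract

    -- An edge between two leaves either has the colour of a third spoke and closes a rainbow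
    -- triangle, or repeats one of the two spokes at its ends. Two disjoint edges of the latter kind
    -- extend to a rainbow path through the centre.
    fourStar⇒pendant : Contains fourStar → Contains pendant
    fourStar⇒pendant (_ , ρ! , occ) = from-just (solve (find pendant)
      ((1F , 3F) ∷ (2F , 4F) ∷ []))
      where open Search χ χ-sym noP₅ ρ! fourStar occ

    -- Two of the colours of the edge 1 4 make 0 1 4 a rainbow triangle with an edge of the fourth
    -- colour attached; the other two complete a rainbow path.
    book⇒pendant : Contains book → Contains pendant
    book⇒pendant (_ , ρ! , occ) = from-just (solve (find pendant) ((1F , 4F) ∷ []))
      where open Search χ χ-sym noP₅ ρ! book occ

    ¬twinned : 6 ≤ n → ¬ Contains twinned
    ¬twinned n≥6 (ρ , ρ! , occ) with fresh ρ n≥6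
    ... | w , w# = from-just (solve {⊥} (λ _ → nothing) ((4F , 0F) ∷ []))
      where open Search χ χ-sym noP₅ (w# ∷ ρ!) (shift twinned) (occurs-shift w ρ twinned occ)

    -- The list contains all six edges that the pattern leaves open on its four vertices and a fifth
    -- one.
    pendant⇒seed : 5 ≤ n → Contains pendant →
                   Contains rainbowStar ⊎ Contains rainbowTriangle ⊎ Contains twinned
    pendant⇒seed n≥5 (ρ , ρ! , occ) with fresh ρ n≥5
    ... | w , w# = from-just (solve
      (find rainbowStar or find rainbowTriangle or find twinned)
      ((4F , 0F) ∷ (2F , 0F) ∷ (3F , 4F) ∷ (2F , 4F) ∷ (3F , 0F) ∷ (1F , 0F) ∷ []))
      where open Search χ χ-sym noP₅ (w# ∷ ρ!) (shift pendant) (occurs-shift w ρ pendant occ)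

    -- In any other colour the edge from `v` to vertex 1 of the pattern starts a rainbow path
    -- through the remaining three.
    rainbowStar-outside : ∀ {v ρ} → Unique ρ → Occurs ρ rainbowStar → VecAll.All (v ≢_) ρ →
                          Coloured-like (v ∷ ρ) (2F , 3F) ((2F , 0F) ∷ [])
    rainbowStar-outside {ρ = ρ} ρ! occ v# = from-just (solve
      (coloured-like (2F , 3F) ((2F , 0F) ∷ []))
      ((2F , 0F) ∷ []))
      where open Search χ χ-sym noP₅ (v# ∷ ρ!) (shift rainbowStar)
                   (occurs-shift _ ρ rainbowStar occ)

    -- The pattern is symmetric in its vertices 1, 2 and 3, so 2 and 3 are joined to new vertices in
    -- the dominant colour as well.
    rainbowStar-rims : ∀ {u v ρ} → Unique (u ∷ v ∷ ρ) → Occurs ρ rainbowStar →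
                       Coloured-like (u ∷ v ∷ ρ) (3F , 4F) starRims
    rainbowStar-rims {ρ = ρ} uvρ! occ = from-just (solve
      (coloured-like (3F , 4F) starRims)
      ((3F , 1F) ∷ (3F , 0F) ∷ (5F , 1F) ∷ (4F , 0F) ∷ []))
      where open Search χ χ-sym noP₅ uvρ! (shift (shift rainbowStar))
                   (occurs-shift _ _ (shift rainbowStar) (occurs-shift _ ρ rainbowStar occ))

    rainbowTriangle-outside : ∀ {v ρ} → Unique ρ → Occurs ρ rainbowTriangle →
                              VecAll.All (v ≢_) ρ →
                              Coloured-like (v ∷ ρ) (4F , 2F) ((4F , 0F) ∷ [])
    rainbowTriangle-outside {ρ = ρ} ρ! occ v# = from-just (solve
      (coloured-like (4F , 2F) ((4F , 0F) ∷ []))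
      ((4F , 0F) ∷ []))
      where open Search χ χ-sym noP₅ (v# ∷ ρ!) (shift rainbowTriangle)
                   (occurs-shift _ ρ rainbowTriangle occ)

    -- Only the first two alternatives consist of disjoint edges; the other four call for a third
    -- new vertex.
    rainbowTriangle-rims : ∀ {u v ρ} → Unique (u ∷ v ∷ ρ) → Occurs ρ rainbowTriangle →
                           Any (Coloured-like (u ∷ v ∷ ρ) (5F , 3F)) triangleRims
    rainbowTriangle-rims {ρ = ρ} uvρ! occ = from-just (solve
      (some-coloured-like (5F , 3F) triangleRims)
      ((5F , 0F) ∷ (3F , 0F) ∷ (2F , 5F) ∷ (0F , 1F) ∷ (4F , 1F) ∷ []))
      where open Search χ χ-sym noP₅ uvρ! (shift (shift rainbowTriangle))
                   (occurs-shift _ _ (shift rainbowTriangle) (occurs-shift _ ρ rainbowTriangle occ))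

  -- Vertices that see three colours.

  sees-all⇒pendant : ∀ {a} → (∀ c → Sees a c) → Contains pendant
  sees-all⇒pendant {a} sees = fourStar⇒pendant
    ( a ∷ Vec.map leaf palette
    , (a≢ 0F ∷ a≢ 1F ∷ a≢ 2F ∷ a≢ 3F ∷ []) ∷
        unique-map⁺ (λ {c} {d} eq → colour-injective c d (cong (χ a) eq)) palette!
    , unique-map⁺ {f = χ a ∘ leaf} (λ {c} {d} → colour-injective c d) palette!
    , [])
    where
    palette : Vec (Fin 4) 4
    palette = 0F ∷ 1F ∷ 2F ∷ 3F ∷ []
    palette! : Unique palette
    palette! = from-yes (unique? palette)
    leaf : Fin 4 → Fin n
    leaf c = proj₁ (sees c)
    a≢ : ∀ c → a ≢ leaf c
    a≢ c = proj₁ (proj₂ (sees c))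
    colour-injective : ∀ c d → χ a (leaf c) ≡ χ a (leaf d) → c ≡ d
    colour-injective c d eq =
      trans (sym (proj₂ (proj₂ (sees c)))) (trans eq (proj₂ (proj₂ (sees d))))

  module _ {a} l (sees : ∀ c → c ≢ l → Sees a c) where

    sees-last⇒pendant : Sees a l → Contains pendant
    sees-last⇒pendant al = sees-all⇒pendant λ c → case c Fin.≟ l of λ where
      (yes refl) → al
      (no c≢l)   → sees c c≢l

    -- Let `u v` be an edge of colour `l`. Unless `a` sees `l`, it is joined to `u` and `v` in other
    -- colours. If these differ, `a u v` is a rainbow triangle and `a` sees the fourth colour; if
    -- they agree, neighbours of `a` in the two remaining colours complete a `book`.
    sees-other-colours⇒pendant : Contains pendant
    sees-other-colours⇒pendant with exact l
    ... | u , v , u≢v , uv≡l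
      with a Fin.≟ u | a Fin.≟ v | χ a u Fin.≟ l | χ a v Fin.≟ l | χ a u Fin.≟ χ a v
    ... | yes refl | _        | _        | _        | _ =
      sees-last⇒pendant (v , u≢v , uv≡l)
    ... | no _     | yes refl | _        | _        | _ =
      sees-last⇒pendant (u , ≢-sym u≢v , trans (χ-sym v u) uv≡l)
    ... | no a≢u   | no _     | yes au≡l | _        | _ = sees-last⇒pendant (u , a≢u , au≡l)
    ... | no _     | no a≢v   | no _     | yes av≡l | _ = sees-last⇒pendant (v , a≢v , av≡l)
    ... | no a≢u   | no a≢v   | no au≢l  | no av≢l  | no au≢av
      with fresh (χ a u ∷ χ a v ∷ l ∷ []) ℕ.≤-refl
    ... | p , p≢au ∷ p≢av ∷ p≢l ∷ [] with sees p p≢l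
    ... | b , a≢b , refl =
        a ∷ u ∷ v ∷ b ∷ []
      , ( (a≢u ∷ a≢v ∷ a≢b ∷ [])
        ∷ (u≢v ∷ apart-colours (≢-sym p≢au) ∷ [])
        ∷ (apart-colours (≢-sym p≢av) ∷ [])
        ∷ [] ∷ [])
      , subst (λ k → Unique (k ∷ χ a v ∷ χ a u ∷ χ a b ∷ [])) (sym uv≡l)
        ( (≢-sym av≢l ∷ ≢-sym au≢l ∷ ≢-sym p≢l ∷ [])
        ∷ (≢-sym au≢av ∷ ≢-sym p≢av ∷ [])
        ∷ (≢-sym p≢au ∷ [])
        ∷ [] ∷ [])
      , []
    sees-other-colours⇒pendant | u , v , u≢v , uv≡l
        | no a≢u   | no a≢v   | no au≢l  | no av≢l  | yes au≡av
      with fresh (χ a u ∷ l ∷ []) (ℕ.n≤1+n 3)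
    ... | p , p≢au ∷ p≢l ∷ [] with fresh (p ∷ χ a u ∷ l ∷ []) ℕ.≤-refl
    ... | q , q≢p ∷ q≢au ∷ q≢l ∷ [] with sees p p≢l | sees q q≢l
    ... | b , a≢b , refl | d , a≢d , refl = book⇒pendant
      ( a ∷ u ∷ v ∷ b ∷ d ∷ []
      , ( (a≢u ∷ a≢v ∷ a≢b ∷ a≢d ∷ [])
        ∷ (u≢v ∷ apart-colours (≢-sym p≢au) ∷ apart-colours (≢-sym q≢au) ∷ [])
        ∷ ( apart-colours (λ eq → p≢au (trans (sym eq) (sym au≡av)))
          ∷ apart-colours (λ eq → q≢au (trans (sym eq) (sym au≡av))) ∷ [])
        ∷ (apart-colours (≢-sym q≢p) ∷ [])
        ∷ [] ∷ [])
      , subst (λ k → Unique (χ a u ∷ χ a b ∷ χ a d ∷ k ∷ [])) (sym uv≡l)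
        ( (≢-sym p≢au ∷ ≢-sym q≢au ∷ au≢l ∷ [])
        ∷ (≢-sym q≢p ∷ p≢l ∷ [])
        ∷ (q≢l ∷ [])
        ∷ [] ∷ [])
      , sym au≡av ∷ [])

  sees-three⇒pendant : ∀ {a i j k} → Unique (i ∷ j ∷ k ∷ []) →
                       Sees a i → Sees a j → Sees a k → Contains pendant
  sees-three⇒pendant {a} {i} {j} {k} ijk! ai aj ak
    with fresh (i ∷ j ∷ k ∷ []) ℕ.≤-refl
  ... | l , l# = sees-other-colours⇒pendant l sees
    where
    sees : ∀ c → c ≢ l → Sees a c
    sees c c≢l with covers (l# ∷ ijk!) c
    ... | 0F , c≡l  = ⊥-elim (c≢l c≡l)
    ... | 1F , refl = ai
    ... | 2F , refl = aj
    ... | 3F , refl = ak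

  -- If `i` and `j` meet at `a` while `k` and `l` meet at `b`, then either `a` and `b` coincide or
  -- the edge `a b` adds a third colour at one of them.
  one-apart : ∀ {i j k l} → Unique (i ∷ j ∷ k ∷ l ∷ []) →
              Contains pendant ⊎ Apart i j ⊎ Apart k l
  one-apart {i} {j} {k} {l}
    ((i≢j ∷ i≢k ∷ i≢l ∷ []) ∷ (j≢k ∷ j≢l ∷ []) ∷ (k≢l ∷ []) ∷ [] ∷ [])
    with apart? i j | apart? k l
  ... | inj₂ apart | _          = inj₂ (inj₁ apart)
  ... | inj₁ _     | inj₂ apart = inj₂ (inj₂ apart)
  ... | inj₁ (a , ai , aj) | inj₁ (b , bk , bl) = inj₁ pendant-found
    where
    ijk! : Unique (i ∷ j ∷ k ∷ [])
    ijk! = (i≢j ∷ i≢k ∷ []) ∷ (j≢k ∷ []) ∷ [] ∷ []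
    ijl! : Unique (i ∷ j ∷ l ∷ [])
    ijl! = (i≢j ∷ i≢l ∷ []) ∷ (j≢l ∷ []) ∷ [] ∷ []
    ikl! : Unique (i ∷ k ∷ l ∷ [])
    ikl! = (i≢k ∷ i≢l ∷ []) ∷ (k≢l ∷ []) ∷ [] ∷ []
    jkl! : Unique (j ∷ k ∷ l ∷ [])
    jkl! = (j≢k ∷ j≢l ∷ []) ∷ (k≢l ∷ []) ∷ [] ∷ []
    pendant-found : Contains pendant
    pendant-found with a Fin.≟ b
    ... | yes refl = sees-three⇒pendant ijk! ai aj bk
    ... | no a≢b with covers {xs = i ∷ j ∷ k ∷ l ∷ []} ((i≢j ∷ i≢k ∷ i≢l ∷ []) ∷ jkl!) (χ a b)
    ... | 0F , ab≡i = sees-three⇒pendant ikl! (a , ≢-sym a≢b , trans (χ-sym b a) ab≡i) bk bl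
    ... | 1F , ab≡j = sees-three⇒pendant jkl! (a , ≢-sym a≢b , trans (χ-sym b a) ab≡j) bk bl
    ... | 2F , ab≡k = sees-three⇒pendant ijk! ai aj (b , a≢b , ab≡k)
    ... | 3F , ab≡l = sees-three⇒pendant ijl! ai aj (b , a≢b , ab≡l)

  -- Whatever its colour, an edge joining an end of an `i`-edge to an end of a `j`-edge makes `i`
  -- meet another colour.
  not-isolated : ∀ {i j k l} → Unique (i ∷ j ∷ k ∷ l ∷ []) →
                 Apart i j → Apart i k → ¬ Apart i l
  not-isolated {i} {j} {k} {l} ijkl! ij ik il with exact i | exact j
  ... | x , y , x≢y , xy≡i | z , w , z≢w , zw≡j
    with x Fin.≟ z | covers ijkl! (χ x z)
  ... | yes refl | _         = ij (y , x≢y , xy≡i) (w , z≢w , zw≡j)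
  ... | no x≢z   | 0F , xz≡i = ij (x , ≢-sym x≢z , trans (χ-sym z x) xz≡i) (w , z≢w , zw≡j)
  ... | no x≢z   | 1F , xz≡j = ij (y , x≢y , xy≡i) (z , x≢z , xz≡j)
  ... | no x≢z   | 2F , xz≡k = ik (y , x≢y , xy≡i) (z , x≢z , xz≡k)
  ... | no x≢z   | 3F , xz≡l = il (y , x≢y , xy≡i) (z , x≢z , xz≡l)

  record ThreeApart : Set where
    field
      {i j k} : Fin 4
      ijk!    : Unique (i ∷ j ∷ k ∷ [])
      ij      : Apart i j
      ik      : Apart i k
      jk      : Apart j k

  -- Each of the three splittings of the colours into two pairs yields an apart pair. Of the eight
  -- choices, four isolate one colour and four form a triangle on three colours.
  pendant-or-three-apart : Contains pendant ⊎ ThreeApart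
  pendant-or-three-apart
    with one-apart (from-yes (unique? (0F ∷ 1F ∷ 2F ∷ 3F ∷ [])))
       | one-apart (from-yes (unique? (0F ∷ 2F ∷ 1F ∷ 3F ∷ [])))
       | one-apart (from-yes (unique? (0F ∷ 3F ∷ 1F ∷ 2F ∷ [])))
  ... | inj₁ found | _ | _ = inj₁ found
  ... | inj₂ _ | inj₁ found | _ = inj₁ found
  ... | inj₂ _ | inj₂ _ | inj₁ found = inj₁ found
  ... | inj₂ (inj₁ p₀₁) | inj₂ (inj₁ p₀₂) | inj₂ (inj₁ p₀₃) = ⊥-elim
    (not-isolated (from-yes (unique? (0F ∷ 1F ∷ 2F ∷ 3F ∷ []))) p₀₁ p₀₂ p₀₃)
  ... | inj₂ (inj₁ p₀₁) | inj₂ (inj₂ p₁₃) | inj₂ (inj₂ p₁₂) = ⊥-elim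
    (not-isolated (from-yes (unique? (1F ∷ 0F ∷ 2F ∷ 3F ∷ []))) (apart-sym p₀₁) p₁₂ p₁₃)
  ... | inj₂ (inj₂ p₂₃) | inj₂ (inj₁ p₀₂) | inj₂ (inj₂ p₁₂) = ⊥-elim
    (not-isolated (from-yes (unique? (2F ∷ 0F ∷ 1F ∷ 3F ∷ [])))
      (apart-sym p₀₂) (apart-sym p₁₂) p₂₃)
  ... | inj₂ (inj₂ p₂₃) | inj₂ (inj₂ p₁₃) | inj₂ (inj₁ p₀₃) = ⊥-elim
    (not-isolated (from-yes (unique? (3F ∷ 0F ∷ 1F ∷ 2F ∷ [])))
      (apart-sym p₀₃) (apart-sym p₁₃) (apart-sym p₂₃))
  ... | inj₂ (inj₁ p₀₁) | inj₂ (inj₁ p₀₂) | inj₂ (inj₂ p₁₂) = inj₂ record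
    { ijk! = from-yes (unique? (0F ∷ 1F ∷ 2F ∷ [])) ; ij = p₀₁ ; ik = p₀₂ ; jk = p₁₂ }
  ... | inj₂ (inj₁ p₀₁) | inj₂ (inj₂ p₁₃) | inj₂ (inj₁ p₀₃) = inj₂ record
    { ijk! = from-yes (unique? (0F ∷ 1F ∷ 3F ∷ [])) ; ij = p₀₁ ; ik = p₀₃ ; jk = p₁₃ }
  ... | inj₂ (inj₂ p₂₃) | inj₂ (inj₁ p₀₂) | inj₂ (inj₁ p₀₃) = inj₂ record
    { ijk! = from-yes (unique? (0F ∷ 2F ∷ 3F ∷ [])) ; ij = p₀₂ ; ik = p₀₃ ; jk = p₂₃ }
  ... | inj₂ (inj₂ p₂₃) | inj₂ (inj₂ p₁₃) | inj₂ (inj₂ p₁₂) = inj₂ record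
    { ijk! = from-yes (unique? (1F ∷ 2F ∷ 3F ∷ [])) ; ij = p₁₂ ; ik = p₁₃ ; jk = p₂₃ }

  -- Hubs from the seed patterns.

  module _ {t} (t+2≤1+n : t + 2 ≤ suc n) (7≤n : 7 ≤ n) where

    dominating⇒hub : ∀ {x a y z u w c} → Unique (x ∷ a ∷ y ∷ z ∷ u ∷ w ∷ []) →
      (∀ v → x ≢ v → a ≢ v → χ x v ≡ c) → χ y z ≡ c → χ u w ≡ c → Hub t
    dominating⇒hub {x} {a} (x# ∷ a# ∷ leaves!) dominates yz≡ uw≡ = record
      { exceptions = x ∷ a ∷ []
      ; leaves!    = leaves!
      ; leaves∉    = VecAll.map (λ (x≢v , a≢v) → λ where
          (here v≡x)         → x≢v (sym v≡x)
          (there (here v≡a)) → a≢v (sym v≡a)) (VecAll.zip (VecAll.tail x# , a#))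
      ; centre∈    = here refl
      ; dominates  = λ {v} v∉ → dominates v (λ { refl → v∉ (here refl) })
                                            (λ { refl → v∉ (there (here refl)) })
      ; yz≡        = yz≡
      ; uw≡        = uw≡
      ; few        = t+2≤1+n
      }

    relabel : ∀ {m k} {ρ : Vec (Fin n) m} → Unique ρ → (τ : Vec (Fin m) k) →
              {True (unique? τ)} → Unique (Vec.map (lookup ρ) τ)
    relabel ρ! τ {τ!} = unique-map⁺ (λ {i} {j} → lookup-injective ρ! i j) (toWitness τ!)

    rainbowStar⇒hub : Contains rainbowStar → Hub t
    rainbowStar⇒hub (ρ@(a ∷ b ∷ c ∷ d ∷ []) , ρ! , occ@(_ , bd≡bc ∷ _)) =
      let v , v# = fresh ρ (ℕ.≤-trans (ℕ.m≤n+m 5 2) 7≤n)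
          u , u# = fresh (v ∷ ρ) (ℕ.≤-trans (ℕ.n≤1+n 6) 7≤n)
          uvρ!   = u# ∷ v# ∷ ρ!
      in case rainbowStar-rims uvρ! occ of λ where
        (cu≡bc ∷ dv≡bc ∷ []) → dominating⇒hub
          (relabel uvρ! (3F ∷ 2F ∷ 4F ∷ 0F ∷ 5F ∷ 1F ∷ [])) turned cu≡bc dv≡bc
      where
      turned : ∀ w → b ≢ w → a ≢ w → χ b w ≡ χ b c
      turned w b≢w a≢w = case locate ρ w of λ where
        (inj₁ (0F , w≡a))  → ⊥-elim (a≢w (sym w≡a))
        (inj₁ (1F , w≡b))  → ⊥-elim (b≢w (sym w≡b))
        (inj₁ (2F , refl)) → refl
        (inj₁ (3F , refl)) → bd≡bc
        (inj₂ w#)          → All.head (rainbowStar-outside ρ! occ w#)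

    rainbowTriangle⇒hub : Contains rainbowTriangle → Hub t
    rainbowTriangle⇒hub (ρ@(a ∷ b ∷ c ∷ x ∷ []) , ρ! , occ@(_ , xc≡xb ∷ [])) =
      let v , v# = fresh ρ (ℕ.≤-trans (ℕ.m≤n+m 5 2) 7≤n)
          u , u# = fresh (v ∷ ρ) (ℕ.≤-trans (ℕ.n≤1+n 6) 7≤n)
          w , w# = fresh (u ∷ v ∷ ρ) 7≤n
      in hub (w# ∷ u# ∷ v# ∷ ρ!)
      where
      κ : Fin 4
      κ = χ x b

      turned : ∀ v → x ≢ v → a ≢ v → χ x v ≡ κ
      turned v x≢v a≢v = case locate ρ v of λ where
        (inj₁ (0F , v≡a))  → ⊥-elim (a≢v (sym v≡a))
        (inj₁ (1F , refl)) → refl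
        (inj₁ (2F , refl)) → xc≡xb
        (inj₁ (3F , v≡x))  → ⊥-elim (x≢v (sym v≡x))
        (inj₂ v#)          → All.head (rainbowTriangle-outside ρ! occ v#)

      hub-or-leaf : ∀ {u v} → Unique (u ∷ v ∷ ρ) → Hub t ⊎
        (χ u v ≡ κ × (χ b u ≡ κ ⊎ χ c u ≡ κ ⊎ χ b v ≡ κ ⊎ χ c v ≡ κ))
      hub-or-leaf uvρ! = case rainbowTriangle-rims uvρ! occ of λ where
        (here (bu ∷ cv ∷ [])) → inj₁ (dominating⇒hub
          (relabel uvρ! (5F ∷ 2F ∷ 3F ∷ 0F ∷ 4F ∷ 1F ∷ [])) turned bu cv)
        (there (here (bv ∷ cu ∷ []))) → inj₁ (dominating⇒hub
          (relabel uvρ! (5F ∷ 2F ∷ 3F ∷ 1F ∷ 4F ∷ 0F ∷ [])) turned bv cu)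
        (there (there (here (uv ∷ bu ∷ [])))) → inj₂ (uv , inj₁ bu)
        (there (there (there (here (uv ∷ cu ∷ []))))) → inj₂ (uv , inj₂ (inj₁ cu))
        (there (there (there (there (here (uv ∷ bv ∷ [])))))) →
          inj₂ (uv , inj₂ (inj₂ (inj₁ bv)))
        (there (there (there (there (there (here (uv ∷ cv ∷ []))))))) →
          inj₂ (uv , inj₂ (inj₂ (inj₂ cv)))

      hub : ∀ {u v w} → Unique (w ∷ u ∷ v ∷ ρ) → Hub t
      -- If no pair of new vertices gives a hub, all three edges among them have colour `κ`. An edge
      -- of that colour from `b` or `c` to one of `u`, `v` is then paired with the edge from `w` to
      -- the other.
      hub {u} {v} {w} wuvρ!
        with hub-or-leaf (relabel wuvρ! (1F ∷ 2F ∷ 3F ∷ 4F ∷ 5F ∷ 6F ∷ []))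
           | hub-or-leaf (relabel wuvρ! (0F ∷ 1F ∷ 3F ∷ 4F ∷ 5F ∷ 6F ∷ []))
           | hub-or-leaf (relabel wuvρ! (0F ∷ 2F ∷ 3F ∷ 4F ∷ 5F ∷ 6F ∷ []))
      ... | inj₁ found | _ | _ = found
      ... | inj₂ _ | inj₁ found | _ = found
      ... | inj₂ _ | inj₂ _ | inj₁ found = found
      ... | inj₂ (_ , inj₁ bu) | _ | inj₂ (wv , _) = dominating⇒hub
          (relabel wuvρ! (6F ∷ 3F ∷ 4F ∷ 1F ∷ 0F ∷ 2F ∷ [])) turned bu wv
      ... | inj₂ (_ , inj₂ (inj₁ cu)) | _ | inj₂ (wv , _) = dominating⇒hub
          (relabel wuvρ! (6F ∷ 3F ∷ 5F ∷ 1F ∷ 0F ∷ 2F ∷ [])) turned cu wv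
      ... | inj₂ (_ , inj₂ (inj₂ (inj₁ bv))) | inj₂ (wu , _) | _ = dominating⇒hub
          (relabel wuvρ! (6F ∷ 3F ∷ 4F ∷ 2F ∷ 0F ∷ 1F ∷ [])) turned bv wu
      ... | inj₂ (_ , inj₂ (inj₂ (inj₂ cv))) | inj₂ (wu , _) | _ = dominating⇒hub
          (relabel wuvρ! (6F ∷ 3F ∷ 5F ∷ 2F ∷ 0F ∷ 1F ∷ [])) turned cv wu

  -- Hubs from three pairwise apart colours.

  leftover : ∀ {i j k c d : Fin 4} → Unique (i ∷ j ∷ k ∷ []) →
             VecAll.All (c ≢_) (i ∷ j ∷ k ∷ []) → VecAll.All (d ≢_) (i ∷ j ∷ k ∷ []) → c ≡ d
  leftover {c = c} {d} ijk! c# d# with c Fin.≟ d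
  ... | yes c≡d = c≡d
  ... | no c≢d  = ⊥-elim (ℕ.1+n≰n (unique⇒≤ ((c≢d ∷ c#) ∷ d# ∷ ijk!)))

  block : Fin 4 → List (Fin n)
  block c = List.filter (λ v → sees? v c) (List.allFin n)

  ∈-block⁺ : ∀ {v c} → Sees v c → v ∈ block c
  ∈-block⁺ vc = ∈-filter⁺ (λ v → sees? v _) (∈-allFin _) vc

  ∈-block⁻ : ∀ {v c} → v ∈ block c → Sees v c
  ∈-block⁻ v∈ = proj₂ (∈-filter⁻ (λ v → sees? v _) {xs = List.allFin n} v∈)

  block! : ∀ c → ListUnique.Unique (block c)
  block! c = ListUnique.filter⁺ (λ v → sees? v c) (ListUnique.allFin⁺ n)

  blocks-fit : ∀ {i j k} → Apart i j → Apart i k → Apart j k →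
    List.length (block i) + (List.length (block j) + List.length (block k)) ≤ n
  blocks-fit {i} {j} {k} ij ik jk = begin
    List.length (block i) + (List.length (block j) + List.length (block k))
      ≡⟨ cong (List.length (block i) +_) (length-++ (block j)) ⟨
    List.length (block i) + List.length (block j ++ block k)
      ≡⟨ length-++ (block i) ⟨
    List.length (block i ++ block j ++ block k)
      ≤⟨ unique⊆⇒length≤ blocks! (λ {v} _ → ∈-allFin v) ⟩
    List.length (List.allFin n)
      ≡⟨ length-tabulate id ⟩
    n ∎
    where
    open ℕ.≤-Reasoning
    blocks! : ListUnique.Unique (block i ++ block j ++ block k)
    blocks! = ListUnique.++⁺ (block! i)
      (ListUnique.++⁺ (block! j) (block! k) (λ (v∈j , v∈k) → jk (∈-block⁻ v∈j) (∈-block⁻ v∈k)))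
      (λ (v∈i , v∈jk) → [ ij (∈-block⁻ v∈i) ∘ ∈-block⁻ , ik (∈-block⁻ v∈i) ∘ ∈-block⁻ ]
        (∈-++⁻ (block j) v∈jk))

  -- Edges leaving block `i` from `x`, and edges between blocks `j` and `k`, can have none of the
  -- three colours, so all have the fourth; two disjoint ones between `j` and `k` close the
  -- triangles.
  apart-hub : ∀ {t i j k} → Unique (i ∷ j ∷ k ∷ []) → Apart i j → Apart i k → Apart j k →
              t + List.length (block i) ≤ suc n → Hub t
  apart-hub {t} {i} {j} {k} ijk! ij ik jk few with exact i | exact j | exact k
  ... | x , x′ , x≢x′ , xi | y , y′ , y≢y′ , yj | z , z′ , z≢z′ , zk = record
    { exceptions = block i
    ; leaves!    = (≢-jk yJ zK ∷ y≢y′ ∷ ≢-jk yJ z′K ∷ [])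
                 ∷ (≢-sym (≢-jk y′J zK) ∷ z≢z′ ∷ [])
                 ∷ (≢-jk y′J z′K ∷ []) ∷ [] ∷ []
    ; leaves∉    = (λ y∈ → ij (∈-block⁻ y∈) yJ) ∷ (λ z∈ → ik (∈-block⁻ z∈) zK)
                 ∷ (λ y′∈ → ij (∈-block⁻ y′∈) y′J) ∷ (λ z′∈ → ik (∈-block⁻ z′∈) z′K) ∷ []
    ; centre∈    = ∈-block⁺ xI
    ; dominates  = λ {v} v∉ → leftover ijk! (across v (v∉ ∘ ∈-block⁺)) (across-jk yJ zK)
    ; yz≡        = refl
    ; uw≡        = leftover ijk! (across-jk y′J z′K) (across-jk yJ zK)
    ; few        = few
    }
    where
    xI : Sees x i
    xI = x′ , x≢x′ , xi
    yJ : Sees y j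
    yJ = y′ , y≢y′ , yj
    y′J : Sees y′ j
    y′J = y , ≢-sym y≢y′ , trans (χ-sym y′ y) yj
    zK : Sees z k
    zK = z′ , z≢z′ , zk
    z′K : Sees z′ k
    z′K = z , ≢-sym z≢z′ , trans (χ-sym z′ z) zk
    ≢-jk : ∀ {u v} → Sees u j → Sees v k → u ≢ v
    ≢-jk uj vk refl = jk uj vk
    across : ∀ v → ¬ Sees v i → VecAll.All (χ x v ≢_) (i ∷ j ∷ k ∷ [])
    across v ¬vi = (λ xv≡i → ¬vi (x , ≢-sym x≢v , trans (χ-sym v x) xv≡i))
                 ∷ (λ xv≡j → ij xI (v , x≢v , xv≡j)) ∷ (λ xv≡k → ik xI (v , x≢v , xv≡k)) ∷ []
      where
      x≢v : x ≢ v
      x≢v refl = ¬vi xI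
    across-jk : ∀ {u v} → Sees u j → Sees v k → VecAll.All (χ u v ≢_) (i ∷ j ∷ k ∷ [])
    across-jk {u} {v} uj vk =
      (λ uv≡i → ij (v , ≢-jk uj vk , uv≡i) uj) ∷
      (λ uv≡j → jk (u , ≢-sym (≢-jk uj vk) , trans (χ-sym v u) uv≡j) vk) ∷
      (λ uv≡k → jk uj (v , ≢-jk uj vk , uv≡k)) ∷ []

  module _ {t p} (2≤p : 2 ≤ p) (t≤3+2p : t ≤ 3 + 2 * p) (t+p≤1+n : t + p ≤ suc n)
    (7≤n : 7 ≤ n) where

    -- If `s` exceeds `p`, then `t + s` is at most `1 + 2 * suc p + s`, hence at most `1 + 3 * s`.
    third⇒few : ∀ s → s + (s + s) ≤ n → t + s ≤ suc n
    third⇒few s 3s≤n with s ℕ.≤? p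
    ... | yes s≤p = ℕ.≤-trans (ℕ.+-monoʳ-≤ t s≤p) t+p≤1+n
    ... | no s≰p  = begin
      t + s                   ≤⟨ ℕ.+-monoˡ-≤ s t≤3+2p ⟩
      3 + 2 * p + s           ≡⟨ rearrange p s ⟩
      suc (suc p + suc p + s) ≤⟨ s≤s (ℕ.+-monoˡ-≤ s (ℕ.+-mono-≤ (ℕ.≰⇒> s≰p) (ℕ.≰⇒> s≰p))) ⟩
      suc (s + s + s)         ≡⟨ cong suc (ℕ.+-assoc s s s) ⟩
      suc (s + (s + s))       ≤⟨ s≤s 3s≤n ⟩
      suc n                   ∎
      where
      open ℕ.≤-Reasoning
      rearrange : ∀ p s → 3 + 2 * p + s ≡ suc (suc p + suc p + s)
      rearrange = solve-∀

    least-apart-hub : ∀ {i j k} → Unique (i ∷ j ∷ k ∷ []) → Apart i j → Apart i k → Apart j k →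
      List.length (block i) ≤ List.length (block j) →
      List.length (block i) ≤ List.length (block k) → Hub t
    least-apart-hub {i} ijk! ij ik jk i≤j i≤k = apart-hub ijk! ij ik jk
      (third⇒few _ (ℕ.≤-trans (ℕ.+-monoʳ-≤ (List.length (block i)) (ℕ.+-mono-≤ i≤j i≤k))
        (blocks-fit ij ik jk)))

    three-apart⇒hub : ThreeApart → Hub t
    three-apart⇒hub record { i = i ; j = j ; k = k
      ; ijk! = ijk!@((i≢j ∷ i≢k ∷ []) ∷ (j≢k ∷ []) ∷ [] ∷ []) ; ij = ij ; ik = ik ; jk = jk }
      with ℕ.≤-total (List.length (block i)) (List.length (block j))
         | ℕ.≤-total (List.length (block i)) (List.length (block k))
         | ℕ.≤-total (List.length (block j)) (List.length (block k))
    ... | inj₁ i≤j | inj₁ i≤k | _ = least-apart-hub ijk! ij ik jk i≤j i≤k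
    ... | inj₁ i≤j | inj₂ k≤i | _ = least-apart-hub
      ((≢-sym i≢k ∷ ≢-sym j≢k ∷ []) ∷ (i≢j ∷ []) ∷ [] ∷ [])
      (apart-sym ik) (apart-sym jk) ij k≤i (ℕ.≤-trans k≤i i≤j)
    ... | inj₂ j≤i | _ | inj₁ j≤k = least-apart-hub
      ((≢-sym i≢j ∷ j≢k ∷ []) ∷ (i≢k ∷ []) ∷ [] ∷ []) (apart-sym ij) jk ik j≤i j≤k
    ... | inj₂ j≤i | _ | inj₂ k≤j = least-apart-hub
      ((≢-sym i≢k ∷ ≢-sym j≢k ∷ []) ∷ (i≢j ∷ []) ∷ [] ∷ [])
      (apart-sym ik) (apart-sym jk) ij (ℕ.≤-trans k≤j j≤i) k≤j

    t+2≤1+n : t + 2 ≤ suc n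
    t+2≤1+n = ℕ.≤-trans (ℕ.+-monoʳ-≤ t 2≤p) t+p≤1+n

    seed⇒hub : Contains rainbowStar ⊎ Contains rainbowTriangle ⊎ Contains twinned → Hub t
    seed⇒hub = [ rainbowStar⇒hub t+2≤1+n 7≤n , [ rainbowTriangle⇒hub t+2≤1+n 7≤n
      , ⊥-elim ∘ ¬twinned (ℕ.≤-trans (ℕ.n≤1+n 6) 7≤n) ] ]

    hub-exists : Hub t
    hub-exists = [ seed⇒hub ∘ pendant⇒seed (ℕ.≤-trans (ℕ.m≤n+m 5 2) 7≤n) , three-apart⇒hub ]
      pendant-or-three-apart

-- From patterns and hubs to copies of graphs.

copyIntoK : ∀ {G n} (f : Graph.Vertex G → Fin n) → Injective _≡_ _≡_ f → Copy G (K n)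
copyIntoK {G} f f-injective = record
  { map       = f
  ; injective = f-injective
  ; preserves = λ uv fu≡fv → Graph.adj-irrefl G (f-injective fu≡fv) uv
  }

P₅-step : ∀ {u v : Fin 5} → toℕ v ≡ suc (toℕ u) → ∃ λ e → u ≡ inject₁ e × v ≡ suc e
P₅-step {u} {suc e} eq =
  e , Fin.toℕ-injective (trans (sym (ℕ.suc-injective eq)) (sym (Fin.toℕ-inject₁ e))) , refl

module _ {n} (χ : EdgeColouring 4 (K n)) where
  open EdgeColouring χ
  open Occurrence colour hiding (colour)
  open Hubs colour
  open DecMembership (Fin._≟_ {n}) using (_∈?_)

  rainbow-copy : Contains rainbowP₅ → ∃ (Rainbow χ {P 5})
  rainbow-copy (ρ , ρ! , colours! , _) = copy , rainbow
    where
    copy : Copy (P 5) (K n)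
    copy = copyIntoK (lookup ρ) (λ {i} {j} → lookup-injective ρ! i j)
    named : ∀ e → colour (lookup ρ (inject₁ e)) (lookup ρ (suc e)) ≡
                  lookup (Vec.map (Occurrence.colour colour ρ) (frame rainbowP₅)) e
    named 0F = refl
    named 1F = refl
    named 2F = refl
    named 3F = refl
    same-step : ∀ {u v x y : Fin 5} → toℕ v ≡ suc (toℕ u) → toℕ y ≡ suc (toℕ x) →
                colour (lookup ρ u) (lookup ρ v) ≡ colour (lookup ρ x) (lookup ρ y) →
                u ≡ x × v ≡ y
    same-step uv xy eq with P₅-step uv | P₅-step xy
    ... | d , refl , refl | e , refl , refl
      with refl ← lookup-injective colours! d e (trans (sym (named d)) (trans eq (named e))) =
      refl , refl
    rainbow : Rainbow χ copy
    rainbow (fwd uv) (fwd xy) eq = inj₁ (same-step uv xy eq)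
    rainbow (fwd uv) (bwd yx) eq = inj₂ (same-step uv yx (trans eq (colour-sym _ _)))
    rainbow (bwd vu) (fwd xy) eq = inj₂ (Product.swap (same-step vu xy (trans (colour-sym _ _) eq)))
    rainbow (bwd vu) (bwd yx) eq =
      inj₁ (Product.swap (same-step vu yx (trans (colour-sym _ _) (trans eq (colour-sym _ _)))))

  module HubCopy {t} (hub : Hub t) where
    open Hub hub

    used : List (Fin n)
    used = y ∷ z ∷ u ∷ w ∷ exceptions

    unused? : ∀ v → Dec (v ∉ used)
    unused? v = ¬? (v ∈? used)

    rest : List (Fin n)
    rest = List.filter unused? (List.allFin n)

    -- The triangle vertices come first: behind the centre they take positions 1 to 4, where `S` has
    -- its rims `1 2` and `3 4`.
    tail : List (Fin n)
    tail = y ∷ z ∷ u ∷ w ∷ rest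

    rest∉ : All (_∉ used) rest
    rest∉ = All.tabulate (λ v∈ → proj₂ (∈-filter⁻ unused? {xs = List.allFin n} v∈))

    tail∉ : All (_∉ exceptions) tail
    tail∉ = case leaves∉ of λ where
      (y∉ ∷ z∉ ∷ u∉ ∷ w∉ ∷ []) → y∉ ∷ z∉ ∷ u∉ ∷ w∉ ∷
        All.map (λ v∉ → v∉ ∘ there ∘ there ∘ there ∘ there) rest∉

    vertices! : ListUnique.Unique (centre ∷ tail)
    vertices! = case leaves! of λ where
        ((y≢z ∷ y≢u ∷ y≢w ∷ []) ∷ (z≢u ∷ z≢w ∷ []) ∷ (u≢w ∷ []) ∷ [] ∷ []) →
          All.map (λ { v∉ refl → v∉ centre∈ }) tail∉
          ListPairs.∷ (y≢z ∷ y≢u ∷ y≢w ∷ ∉rest (here refl))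
          ListPairs.∷ (z≢u ∷ z≢w ∷ ∉rest (there (here refl)))
          ListPairs.∷ (u≢w ∷ ∉rest (there (there (here refl))))
          ListPairs.∷ ∉rest (there (there (there (here refl))))
          ListPairs.∷ ListUnique.filter⁺ unused? (ListUnique.allFin⁺ n)
      where
      ∉rest : ∀ {v} → v ∈ used → All (v ≢_) rest
      ∉rest v∈ = All.map (λ { x∉ refl → x∉ v∈ }) rest∉

    -- `used` and `rest` cover all vertices, and the additional 1 in `few` accounts for the centre,
    -- which heads the list although `used` already holds it as an exception.
    enough : t ≤ List.length (centre ∷ tail)
    enough = ℕ.+-cancelʳ-≤ (List.length exceptions) t _ (begin
      t + List.length exceptions
        ≤⟨ few ⟩
      suc n
        ≡⟨ cong suc (length-tabulate id) ⟨
      suc (List.length (List.allFin n))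
        ≤⟨ s≤s (unique⊆⇒length≤ (ListUnique.allFin⁺ n) (λ {v} _ → used-or-rest v)) ⟩
      suc (List.length (used ++ rest))
        ≡⟨ cong suc (length-++ used) ⟩
      suc (4 + List.length exceptions + List.length rest)
        ≡⟨ cong (5 +_) (ℕ.+-comm (List.length exceptions) (List.length rest)) ⟩
      List.length (centre ∷ tail) + List.length exceptions ∎)
      where
      open ℕ.≤-Reasoning
      used-or-rest : ∀ v → v ∈ used ++ rest
      used-or-rest v with v ∈? used
      ... | yes v∈ = ∈-++⁺ˡ v∈
      ... | no v∉  = ∈-++⁺ʳ used (∈-filter⁺ unused? (∈-allFin v) v∉)

    monochromatic-copy : ∀ {r} → r ≤ 2 → ∃ (Monochromatic χ {S t r})
    monochromatic-copy {r} r≤2 = copyIntoK place place-injective , c , λ where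
        (fwd e) → coloured e
        (bwd e) → trans (colour-sym _ _) (coloured e)
      where
      place : Fin t → Fin n
      place i = List.lookup (centre ∷ tail) (inject≤ i enough)
      place-injective : Injective _≡_ _≡_ place
      place-injective eq =
        Fin.inject≤-injective enough enough _ _ (list-lookup-injective vertices! _ _ eq)
      place-at : ∀ {i} k → toℕ i ≡ toℕ k → place i ≡ List.lookup (centre ∷ tail) k
      place-at k eq = cong (List.lookup (centre ∷ tail))
        (Fin.toℕ-injective (trans (Fin.toℕ-inject≤ _ enough) eq))
      place-leaf : ∀ {i} → toℕ i ≢ 0 → place i ∉ exceptions
      place-leaf {i} i≢0 = at (inject≤ i enough)
        (λ eq → i≢0 (trans (sym (Fin.toℕ-inject≤ i enough)) eq))
        where
        at : ∀ k → toℕ k ≢ 0 → List.lookup (centre ∷ tail) k ∉ exceptions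
        at 0F      k≢0 = ⊥-elim (k≢0 refl)
        at (suc k) _   = All.lookup tail∉ (∈-lookup k)
      coloured : ∀ {i j} → StarEdge r i j → colour (place i) (place j) ≡ c
      coloured {j = j} (spoke i≡0 j≢0) =
        trans (cong (λ v → colour v (place j)) (place-at 0F i≡0)) (dominates (place-leaf j≢0))
      coloured (rim (0 , _ , i≡ , j≡)) =
        trans (cong₂ colour (place-at 1F i≡) (place-at 2F j≡)) yz≡
      coloured (rim (1 , _ , i≡ , j≡)) =
        trans (cong₂ colour (place-at 3F i≡) (place-at 4F j≡)) uw≡
      coloured (rim (suc (suc s) , s<r , _)) =
        ⊥-elim (ℕ.<⇒≱ (ℕ.≤-trans s<r r≤2) (s≤s (s≤s z≤n)))

upper-bound : ∀ {t p r n} → 2 ≤ p → t ≤ 3 + 2 * p → t + p ≤ suc n → 7 ≤ n → r ≤ 2 →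
  (χ : EdgeColouring 4 (K n)) → ∃ (Rainbow χ {P 5}) ⊎ ∃ (Monochromatic χ {S t r})
upper-bound 2≤p t≤3+2p t+p≤1+n 7≤n r≤2 χ with contains? (EdgeColouring.colour χ) rainbowP₅
... | yes p₅  = inj₁ (rainbow-copy χ p₅)
... | no noP₅ = inj₂ (HubCopy.monochromatic-copy χ (hub-exists 2≤p t≤3+2p t+p≤1+n 7≤n) r≤2)
  where
  open EdgeColouring χ
  open P₅Free colour colour-sym exact noP₅

-- The colouring for the lower bound.

module ThreeBlocks (p q : ℕ) {first second : Fin p} (first≢second : first ≢ second) where

  n : ℕ
  n = p * 3 + q

  -- The last q vertices also go to block 0.
  block : Fin n → Fin 3
  block v = [ proj₂ ∘ remQuot {p} 3 , const 0F ]′ (splitAt (p * 3) v)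

  member : Fin 3 → Fin p → Fin n
  member k s = combine s k ↑ˡ q

  block-member : ∀ k s → block (member k s) ≡ k
  block-member k s = trans
    (cong [ proj₂ ∘ remQuot {p} 3 , const 0F ]′ (Fin.splitAt-↑ˡ (p * 3) (combine s k) q))
    (cong proj₂ (Fin.remQuot-combine s k))

  member-injective : ∀ k {s s′} → member k s ≡ member k s′ → s ≡ s′
  member-injective k eq = Fin.combine-injectiveˡ _ k _ k (Fin.↑ˡ-injective q _ _ eq)

  colour : Fin n → Fin n → Fin 4
  colour u v with block u Fin.≟ block v
  ... | yes _ = suc (block u)
  ... | no _  = 0F

  colour-within : ∀ u v → block u ≡ block v → colour u v ≡ suc (block u)
  colour-within u v eq with block u Fin.≟ block v
  ... | yes _ = refl
  ... | no ne = ⊥-elim (ne eq)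

  colour-across : ∀ u v → block u ≢ block v → colour u v ≡ 0F
  colour-across u v ne with block u Fin.≟ block v
  ... | yes eq = ⊥-elim (ne eq)
  ... | no _   = refl

  colour-sym : ∀ u v → colour u v ≡ colour v u
  colour-sym u v with block u Fin.≟ block v
  ... | yes eq = trans (cong suc eq) (sym (colour-within v u (sym eq)))
  ... | no ne  = sym (colour-across v u (≢-sym ne))

  colour≡suc : ∀ u v {k} → colour u v ≡ suc k → block v ≡ k
  colour≡suc u v eq with block u Fin.≟ block v
  colour≡suc u v refl | yes u~v = sym u~v
  colour≡suc u v ()   | no _

  colour≡0 : ∀ u v → colour u v ≡ 0F → block u ≢ block v
  colour≡0 u v eq u~v with () ← trans (sym eq) (colour-within u v u~v)

  -- The `m` images and the `p` members of block `k` are pairwise different vertices.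
  fits : ∀ {m} (f : Fin m → Fin n) → Injective _≡_ _≡_ f → ∀ k →
         (∀ i → block (f i) ≢ k) → m + p ≤ n
  fits {m} f f-injective k avoids = begin
    m + p
      ≡⟨ cong₂ _+_ (length-tabulate f) (length-tabulate (member k)) ⟨
    List.length (List.tabulate f) + List.length (List.tabulate (member k))
      ≡⟨ length-++ (List.tabulate f) ⟨
    List.length (List.tabulate f ++ List.tabulate (member k))
      ≤⟨ unique⊆⇒length≤ vertices! (λ {v} _ → ∈-allFin v) ⟩
    List.length (List.allFin n)
      ≡⟨ length-tabulate id ⟩
    n ∎
    where
    open ℕ.≤-Reasoning
    vertices! : ListUnique.Unique (List.tabulate f ++ List.tabulate (member k))
    vertices! = ListUnique.++⁺ (ListUnique.tabulate⁺ f-injective)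
      (ListUnique.tabulate⁺ (member-injective k)) λ (v∈f , v∈k) →
        let (i , v≡fi) = ∈-tabulate⁻ v∈f
            (s , v≡ks) = ∈-tabulate⁻ v∈k
        in avoids i (trans (cong block (trans (sym v≡fi) v≡ks)) (block-member k s))

  -- Colour 0 never leads into the block of `x`; any other colour leads into a single block.
  avoided-block : ∀ c x → ∃ λ k → ∀ y → colour x y ≡ c → block y ≢ k
  avoided-block 0F            x = block x , λ y eq → ≢-sym (colour≡0 x y eq)
  avoided-block (suc 0F)      x = 1F , λ y eq y∈ → case trans (sym (colour≡suc x y eq)) y∈ of λ ()
  avoided-block (suc (suc _)) x = 0F , λ y eq y∈ → case trans (sym (colour≡suc x y eq)) y∈ of λ ()

  colouring : EdgeColouring 4 (K n)
  colouring = record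
    { colour     = colour
    ; colour-sym = colour-sym
    ; exact      = λ where
        0F      → member 0F first , member 1F first
                , differ ∘ cong block , colour-across _ _ differ
        (suc k) → member k first , member k second
                , first≢second ∘ member-injective k
                , trans (colour-within _ _ (same-block k)) (cong suc (block-member k first))
    }
    where
    differ : block (member 0F first) ≢ block (member 1F first)
    differ eq = case trans (sym (block-member 0F first)) (trans eq (block-member 1F first)) of λ ()
    same-block : ∀ k → block (member k first) ≡ block (member k second)
    same-block k = trans (block-member k first) (sym (block-member k second))

  -- Two consecutive edges inside blocks lie in the same block and share its colour. Hence each half
  -- of the path has an edge of colour 0.
  no-rainbow-P₅ : ∀ f → ¬ Rainbow colouring {P 5} f
  no-rainbow-P₅ f rainbow = [
      (λ z₀₁ → [ clash e₀₁ e₂₃ (λ ()) (λ ()) z₀₁ , clash e₀₁ e₃₄ (λ ()) (λ ()) z₀₁ ]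
        (crossing e₂₃ e₃₄ (λ ()))) ,
      (λ z₁₂ → [ clash e₁₂ e₂₃ (λ ()) (λ ()) z₁₂ , clash e₁₂ e₃₄ (λ ()) (λ ()) z₁₂ ]
        (crossing e₂₃ e₃₄ (λ ())))
    ] (crossing e₀₁ e₁₂ (λ ()))
    where
    open Copy f
    e₀₁ : Graph.Adj (P 5) 0F 1F
    e₀₁ = fwd refl
    e₁₂ : Graph.Adj (P 5) 1F 2F
    e₁₂ = fwd refl
    e₂₃ : Graph.Adj (P 5) 2F 3F
    e₂₃ = fwd refl
    e₃₄ : Graph.Adj (P 5) 3F 4F
    e₃₄ = fwd refl

    clash : ∀ {u v x y} → Graph.Adj (P 5) u v → Graph.Adj (P 5) x y → u ≢ x → u ≢ y →
            colour (map u) (map v) ≡ 0F → ¬ colour (map x) (map y) ≡ 0F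
    clash uv xy u≢x u≢y uv≡0 xy≡0 =
      [ u≢x ∘ proj₁ , u≢y ∘ proj₁ ] (rainbow uv xy (trans uv≡0 (sym xy≡0)))

    crossing : ∀ {u v w} → Graph.Adj (P 5) u v → Graph.Adj (P 5) v w → u ≢ w →
      colour (map u) (map v) ≡ 0F ⊎ colour (map v) (map w) ≡ 0F
    crossing {u} {v} {w} uv vw u≢w =
      case (block (map u) Fin.≟ block (map v)) , (block (map v) Fin.≟ block (map w)) of λ where
        (no u≁v , _)       → inj₁ (colour-across (map u) (map v) u≁v)
        (_ , no v≁w)       → inj₂ (colour-across (map v) (map w) v≁w)
        (yes u~v , yes v~w) → ⊥-elim
          ([ (λ (u≡v , _) → Graph.adj-irrefl (P 5) u≡v uv) , u≢w ∘ proj₁ ]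
            (rainbow uv vw (trans (colour-within (map u) (map v) u~v)
              (trans (cong suc u~v) (sym (colour-within (map v) (map w) v~w))))))

  -- The `2p + q + 1` leaves miss a block, which has `p` further vertices, but there are only
  -- `3p + q` vertices.
  no-monochromatic-S : ∀ r f → ¬ Monochromatic colouring {S (2 + (2 * p + q)) r} f
  no-monochromatic-S r f (c , mono) = ℕ.1+n≰n (begin
    suc n                  ≡⟨ cong suc (rearrange p q) ⟩
    suc (2 * p + q) + p    ≤⟨ fits (map ∘ suc) (Fin.suc-injective ∘ injective)
                                (proj₁ avoided) leaf-avoids ⟩
    n                      ∎)
    where
    open Copy f
    open ℕ.≤-Reasoning
    rearrange : ∀ p q → p * 3 + q ≡ 2 * p + q + p
    rearrange = solve-∀
    avoided : ∃ λ k → ∀ y → colour (map 0F) y ≡ c → block y ≢ k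
    avoided = avoided-block c (map 0F)
    leaf-avoids : ∀ i → block (map (suc i)) ≢ proj₁ avoided
    leaf-avoids i = proj₂ avoided (map (suc i)) (mono (fwd (spoke refl λ ())))

lower-bound : ∀ {p q r} M → 2 ≤ p →
  -- With `p` at least 2, every block contains an edge, so its own colour occurs.
  GallaiRamseyBound 4 (P 5) (S (2 + (2 * p + q)) r) M → suc (2 * p + q + p) ≤ M
lower-bound {p@(suc (suc _))} {q} {r} M (s≤s (s≤s _)) (_ , bound) = ℕ.≰⇒> λ M≤ →
  [ (λ (f , rainbow) → no-rainbow-P₅ f rainbow) , (λ (f , mono) → no-monochromatic-S r f mono) ]
    (bound n (ℕ.≤-trans M≤ (ℕ.≤-reflexive (rearrange p q))) colouring)
  where
  open ThreeBlocks p q {0F} {1F} (λ ())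
  rearrange : ∀ p q → 2 * p + q + p ≡ p * 3 + q
  rearrange = solve-∀

-- Arithmetic and the exact value.

p-at-least-2 : ∀ {p q} → 4 ≤ 2 * p + q → q ≤ 1 → 2 ≤ p
p-at-least-2 4≤ q≤1 = ℕ.≮⇒≥ λ { (s≤s p≤1) →
  ℕ.<⇒≱ 4≤ (ℕ.+-mono-≤ (ℕ.*-monoʳ-≤ 2 p≤1) q≤1) }

n≤[1+n]C2 : ∀ n → n ≤ suc n C 2
n≤[1+n]C2 n = begin
  n               ≡⟨ nC1≡n n ⟨
  n C 1           ≤⟨ ℕ.m≤m+n (n C 1) (n C 2) ⟩
  n C 1 + n C 2   ≡⟨ nCk+nC[k+1]≡[n+1]C[k+1] n 1 ⟩
  suc n C 2       ∎
  where open ℕ.≤-Reasoning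

gr-value : ∀ {p q r} → 6 ≤ 2 + (2 * p + q) → r ≤ 2 → q ≤ 1 →
           gr[ 4 ][ P 5 ∶ S (2 + (2 * p + q)) r ]≡ suc (2 * p + q + p)
gr-value {p} {q} {r} (s≤s (s≤s 4≤m)) r≤2 q≤1 =
  ( ℕ.≤-trans 4≤m (ℕ.≤-trans (ℕ.m≤m+n (2 * p + q) p) (n≤[1+n]C2 (2 * p + q + p)))
  , λ n N≤n χ → upper-bound {2 + (2 * p + q)} {p} {r} {n}
      2≤p t≤3+2p (s≤s N≤n) (ℕ.≤-trans 7≤N N≤n) r≤2 χ) ,
  λ M → lower-bound {p} {q} {r} M 2≤p
  where
  2≤p : 2 ≤ p
  2≤p = p-at-least-2 4≤m q≤1
  t≤3+2p : 2 + (2 * p + q) ≤ 3 + 2 * p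
  t≤3+2p = s≤s (s≤s (ℕ.≤-trans (ℕ.+-monoʳ-≤ (2 * p) q≤1)
    (ℕ.≤-reflexive (ℕ.+-comm (2 * p) 1))))
  7≤N : 7 ≤ suc (2 * p + q + p)
  7≤N = s≤s (ℕ.+-mono-≤ 4≤m 2≤p)

theorem3p2 : ∀ (t r p q : ℕ) → 6 ≤ t → r ≡ 1 ⊎ r ≡ 2 →
    q ≡ 0 ⊎ q ≡ 1 → t ∸ 2 ≡ 2 * p + q →
    gr[ 4 ][ P 5 ∶ S t r ]≡ (t + p ∸ 1)
theorem3p2 t r p q 6≤t r≡ q≡ t-2≡ =
  -- At `2 + (2 * p + q)` in place of `t`, the truncated difference computes to
  -- `suc (2 * p + q + p)`.
  subst (λ t → gr[ 4 ][ P 5 ∶ S t r ]≡ (t + p ∸ 1)) t≡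
    (gr-value {p} {q} {r} (subst (6 ≤_) (sym t≡) 6≤t) r≤2 q≤1)
  where
  t≡ : 2 + (2 * p + q) ≡ t
  t≡ = trans (cong (2 +_) (sym t-2≡)) (ℕ.m+[n∸m]≡n (ℕ.≤-trans (s≤s (s≤s z≤n)) 6≤t))
  r≤2 : r ≤ 2
  r≤2 = [ (λ { refl → s≤s z≤n }) , (λ { refl → ℕ.≤-refl }) ] r≡
  q≤1 : q ≤ 1
  q≤1 = [ (λ { refl → z≤n }) , (λ { refl → ℕ.≤-refl }) ] q≡
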